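{- Let $\alpha$ be an infinite ordinal. There is a $\Delta_2$-formula (in the first-order language of $\mathsf{CA}_\alpha$) which is valid in $\mathsf{Lf}_\alpha$ but is not valid in $\mathsf{RCA}_\alpha$.
   Context: A cylindric algebra of dimension $\alpha$ (a $\mathsf{CA}_\alpha$) is an algebra $\langle A,+,-,c_i,d_{ij}: i,j\in\alpha\rangle$ such that $\langle A,+,-\rangle$ is a Boolean algebra and for all distinct $i,j,k\in\alpha$ and all $x,y\in A$: $c_ic_jx=c_jc_ix$, $x\le c_ix=c_ic_ix$, $c_i(x+y)=c_ix+c_iy$, $c_i-c_ix=-c_ix$, $d_{ii}=1$, $d_{ij}=d_{ji}$, $c_j(d_{ij}\cdot d_{jk})=d_{ik}$, $c_id_{ij}=1$, $d_{ij}\cdot c_i(d_{ij}\cdot x)=d_{ij}\cdot x$. $\mathsf{Lf}_\alpha$ is the class of those $\mathsf{CA}_\alpha$s in which for each element $x$ we have $c_ix=x$ for all but finitely many $i\in\alpha$. For $V\subseteq{}^\alpha U$, the full cylindric set algebra with unit $V$ is $\langle \mathcal P(V),\cup,-,C_i^V,D_{ij}^V : i,j\in\alpha\rangle$, where $C_i^VX=\{s(i/u)\in V : s\in X,\ u\in U\}$ ($s(i/u)$ is $s$ with its value at $i$ changed to $u$) and $D_{ij}^V=\{s\in V : s_i=s_j\}$. $\mathsf{RCA}_\alpha$ is the class of all algebras isomorphic to subalgebras of full cylindric set algebras whose unit is a disjoint union of sets of the form ${}^\alpha U$. A first-order formula is $\Delta_2$ if it is logically equivalent both to a $\Pi_2$-formula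 (prefix $\forall\bar x\exists\bar y$ followed by a quantifier-free formula) and to a $\Sigma_2$-formula (prefix $\exists\bar x\forall\bar y$ followed by a quantifier-free formula). A formula is valid in a class if it is valid in all members of the class. -}

module Defs where

open import Level using (Lift; 0ℓ; _⊔_) renaming (suc to lsuc)
open import Algebra.Core using (Op₁; Op₂)
open import Algebra.Definitions using (Congruent₁; Congruent₂)
open import Algebra.Lattice.Structures using (IsBooleanAlgebra)
open import Data.Fin.Base using (Fin)
open import Data.List.Base using (List)
open import Data.List.Membership.Propositional using (_∉_)
open import Data.Nat.Base using (ℕ; zero; suc; _+_)
open import Data.Product using (Σ; Σ-syntax; ∃; ∃-syntax; _×_; _,_; proj₁; proj₂)
open import Data.Sum using (_⊎_; inj₁; inj₂)
open import Data.Vec.Functional using (Vector; _∷_)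
open import Function.Base using (_on_)
open import Function.Bundles using (_⇔_; _↔_)
open import Function.Structures using (IsBijection)
open import Induction.WellFounded using (WellFounded)
open import Relation.Binary.Core using (Rel)
open import Relation.Binary.Definitions using (_Respects_)
open import Relation.Binary.Structures using (IsEquivalence; IsStrictTotalOrder)
open import Relation.Binary.PropositionalEquality
  using (_≡_; _≢_; refl; sym; trans; _≗_)
open import Relation.Nullary using (¬_; yes; no)
open import Relation.Unary using (Pred; _∈_; _⊆_; _≐_; ⋃)

-- An ordinal is presented as a well-ordered set.
record Ordinal : Set₁ where
  infix 4 _<_
  field
    Index              : Set
    _<_                : Rel Index 0ℓ
    isStrictTotalOrder : IsStrictTotalOrder _≡_ _<_
    wellFounded        : WellFounded _<_

  open IsStrictTotalOrder isStrictTotalOrder public using (_≟_)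

Infinite : Ordinal → Set
Infinite α = ¬ (∃[ n ] (Ordinal.Index α ↔ Fin n))

-- An algebra of the similarity type of CA_α, with no axioms; these are
-- exactly the structures for the first-order language of CA_α.  Equality
-- is an arbitrary congruence.  Sets are modelled by Set, so the power set
-- of a set, and hence the carrier of an algebra, lives in Set₁.
record Structure (α : Ordinal) : Set₂ where
  open Ordinal α using (Index)
  infix  4 _≈_ _≤_
  infixl 6 _⊕_
  infixl 7 _·_
  infix  8 ⊖_
  field
    Carrier       : Set₁
    _≈_           : Rel Carrier 0ℓ
    isEquivalence : IsEquivalence _≈_
    _⊕_           : Op₂ Carrier
    ⊖_            : Op₁ Carrier
    c             : Index → Op₁ Carrier
    d             : Index → Index → Carrier
    ⊕-cong        : Congruent₂ _≈_ _⊕_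
    ⊖-cong        : Congruent₁ _≈_ ⊖_
    c-cong        : ∀ i → Congruent₁ _≈_ (c i)

  _·_ : Op₂ Carrier
  x · y = ⊖ (⊖ x ⊕ ⊖ y)

  _≤_ : Rel Carrier 0ℓ
  x ≤ y = x ⊕ y ≈ y

record IsCA {α : Ordinal} (A : Structure α) : Set₁ where
  open Ordinal α using (Index)
  open Structure A
  field
    𝟏 𝟎       : Carrier
    isBoolean : IsBooleanAlgebra _≈_ _⊕_ _·_ ⊖_ 𝟏 𝟎
    c-comm    : ∀ {i j} → i ≢ j → ∀ x → c i (c j x) ≈ c j (c i x)
    c-incr    : ∀ i x → x ≤ c i x
    c-idem    : ∀ i x → c i x ≈ c i (c i x)
    c-add     : ∀ i x y → c i (x ⊕ y) ≈ c i x ⊕ c i y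
    c-compl   : ∀ i x → c i (⊖ c i x) ≈ ⊖ c i x
    d-refl    : ∀ i → d i i ≈ 𝟏
    d-sym     : ∀ {i j} → i ≢ j → d i j ≈ d j i
    d-trans   : ∀ {i j k} → i ≢ j → i ≢ k → j ≢ k →
                c j (d i j · d j k) ≈ d i k
    c-d       : ∀ {i j} → i ≢ j → c i (d i j) ≈ 𝟏
    d-c       : ∀ {i j} → i ≢ j → ∀ x →
                d i j · c i (d i j · x) ≈ d i j · x

Lf : ∀ {α} → Structure α → Set₁
Lf {α} A = IsCA A ×
  (∀ x → ∃[ L ] (∀ (i : Ordinal.Index α) → i ∉ L → c i x ≈ x))
  where open Structure A

record _≅_ {α : Ordinal} (A B : Structure α) : Set₁ where
  private
    module A = Structure A
    module B = Structure B
  field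
    to          : A.Carrier → B.Carrier
    isBijection : IsBijection A._≈_ B._≈_ to
    ⊕-homo      : ∀ x y → to (x A.⊕ y) B.≈ to x B.⊕ to y
    ⊖-homo      : ∀ x → to (A.⊖ x) B.≈ B.⊖ to x
    c-homo      : ∀ i x → to (A.c i x) B.≈ B.c i (to x)
    d-homo      : ∀ i j → to (A.d i j) B.≈ B.d i j

record IsSubuniverse {α : Ordinal} (B : Structure α)
                     (P : Pred (Structure.Carrier B) (lsuc 0ℓ)) : Set₁ where
  open Structure B
  field
    ⊕-closed : ∀ {x y} → x ∈ P → y ∈ P → (x ⊕ y) ∈ P
    ⊖-closed : ∀ {x} → x ∈ P → (⊖ x) ∈ P
    c-closed : ∀ i {x} → x ∈ P → c i x ∈ P
    d-closed : ∀ i j → d i j ∈ P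

Subalgebra : ∀ {α} (B : Structure α) {P : Pred (Structure.Carrier B) (lsuc 0ℓ)} →
             IsSubuniverse B P → Structure α
Subalgebra B {P} sub = record
  { Carrier       = Σ Carrier P
  ; _≈_           = _≈_ on proj₁
  ; isEquivalence = record { refl = E.refl ; sym = E.sym ; trans = E.trans }
  ; _⊕_           = λ (x , p) (y , q) → x ⊕ y , ⊕-closed p q
  ; ⊖_            = λ (x , p) → ⊖ x , ⊖-closed p
  ; c             = λ i (x , p) → c i x , c-closed i p
  ; d             = λ i j → d i j , d-closed i j
  ; ⊕-cong        = ⊕-cong
  ; ⊖-cong        = ⊖-cong
  ; c-cong        = λ i → c-cong i
  }
  where
  open Structure B
  open IsSubuniverse sub
  module E = IsEquivalence isEquivalence

module _ {α : Ordinal} where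
  open Ordinal α using (Index; _≟_)

  infix 9 _⟨_/_⟩
  _⟨_/_⟩ : ∀ {U : Set} → (Index → U) → Index → U → (Index → U)
  (s ⟨ i / u ⟩) j with j ≟ i
  ... | yes _ = u
  ... | no  _ = s j

  -- A set of α-sequences over U.  Sequences are identified when they agree
  -- pointwise, so that function extensionality is not needed.
  record SeqSet (U : Set) : Set₁ where
    field
      Holds    : Pred (Index → U) 0ℓ
      respects : Holds Respects _≗_

  open SeqSet

  module _ {U : Set} (V : SeqSet U) where

    record Sub : Set₁ where
      field
        set : SeqSet U
        ⊆V  : Holds set ⊆ Holds V

    open Sub

    private
      _∋_ : Sub → Pred (Index → U) 0ℓ
      X ∋ s = Holds (set X) s

    C : Index → Sub → Sub
    C i X = record
      { set = record
        { Holds    = λ t → t ∈ Holds V ×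
                     ∃[ s ] ∃[ u ] ((X ∋ s) × t ≗ s ⟨ i / u ⟩)
        ; respects = λ e (v , s , u , p , q) →
                     respects V e v , s , u , p , λ j → trans (sym (e j)) (q j)
        }
      ; ⊆V = proj₁
      }

    D : Index → Index → Sub
    D i j = record
      { set = record
        { Holds    = λ s → s ∈ Holds V × s i ≡ s j
        ; respects = λ e (v , p) →
                     respects V e v , trans (sym (e i)) (trans p (e j))
        }
      ; ⊆V = proj₁
      }

    _∪_ : Op₂ Sub
    X ∪ Y = record
      { set = record
        { Holds    = λ s → (X ∋ s) ⊎ (Y ∋ s)
        ; respects = λ { e (inj₁ p) → inj₁ (respects (set X) e p)
                       ; e (inj₂ p) → inj₂ (respects (set Y) e p) }
        }
      ; ⊆V = λ { (inj₁ p) → ⊆V X p ; (inj₂ p) → ⊆V Y p }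
      }

    V∖_ : Op₁ Sub
    V∖ X = record
      { set = record
        { Holds    = λ s → s ∈ Holds V × ¬ (X ∋ s)
        ; respects = λ e (v , p) →
                     respects V e v , λ q → p (respects (set X) (λ j → sym (e j)) q)
        }
      ; ⊆V = proj₁
      }

    FullSetAlgebra : Structure α
    FullSetAlgebra = record
      { Carrier       = Sub
      ; _≈_           = λ X Y → (X ∋_) ≐ (Y ∋_)
      ; isEquivalence = record
        { refl  = (λ p → p) , (λ p → p)
        ; sym   = λ (f , g) → g , f
        ; trans = λ (f , g) (h , k) → (λ p → h (f p)) , (λ p → g (k p))
        }
      ; _⊕_    = _∪_
      ; ⊖_     = V∖_
      ; c      = C
      ; d      = D
      ; ⊕-cong = λ (f , g) (h , k) →
                   (λ { (inj₁ p) → inj₁ (f p) ; (inj₂ p) → inj₂ (h p) }) ,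
                   (λ { (inj₁ p) → inj₁ (g p) ; (inj₂ p) → inj₂ (k p) })
      ; ⊖-cong = λ (f , g) →
                   (λ (v , p) → v , λ q → p (g q)) , (λ (v , p) → v , λ q → p (f q))
      ; c-cong = λ i (f , g) →
                   (λ (v , s , u , p , q) → v , s , u , f p , q) ,
                   (λ (v , s , u , p , q) → v , s , u , g p , q)
      }

  -- The set of α-sequences all of whose values lie in W.
  Power : ∀ {U : Set} → Pred U 0ℓ → Pred (Index → U) 0ℓ
  Power W s = ∀ i → s i ∈ W

  record IsDisjointUnionOfPowers {U : Set} (V : SeqSet U) : Set₁ where
    field
      K        : Set
      W        : K → Pred U 0ℓ
      union    : Holds V ≐ ⋃ K (λ k → Power (W k))
      disjoint : ∀ {k l} s → s ∈ Power (W k) → s ∈ Power (W l) → k ≡ l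

  RCA : Structure α → Set₂
  RCA A = Σ[ U ∈ Set ] Σ[ V ∈ SeqSet U ] IsDisjointUnionOfPowers V ×
          Σ[ P ∈ Pred (Sub V) (lsuc 0ℓ) ]
          Σ[ sub ∈ IsSubuniverse (FullSetAlgebra V) P ]
          A ≅ Subalgebra (FullSetAlgebra V) sub

module _ (α : Ordinal) where
  open Ordinal α using (Index)

  data Term (n : ℕ) : Set where
    var  : Fin n → Term n
    _⊕ᵗ_ : Term n → Term n → Term n
    ⊖ᵗ_  : Term n → Term n
    cᵗ   : Index → Term n → Term n
    dᵗ   : Index → Index → Term n

  -- Formulas with n free variables; bound variables are de Bruijn indices.
  data Formula (n : ℕ) : Set where
    _≈ᶠ_           : Term n → Term n → Formula n
    ¬ᶠ_            : Formula n → Formula n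
    _∧ᶠ_ _∨ᶠ_ _⇒ᶠ_ : Formula n → Formula n → Formula n
    ∀ᶠ_ ∃ᶠ_        : Formula (suc n) → Formula n

module _ {α : Ordinal} where

  data QuantifierFree {n : ℕ} : Formula α n → Set where
    eq  : ∀ {t u} → QuantifierFree (t ≈ᶠ u)
    neg : ∀ {φ} → QuantifierFree φ → QuantifierFree (¬ᶠ φ)
    and : ∀ {φ ψ} → QuantifierFree φ → QuantifierFree ψ → QuantifierFree (φ ∧ᶠ ψ)
    or  : ∀ {φ ψ} → QuantifierFree φ → QuantifierFree ψ → QuantifierFree (φ ∨ᶠ ψ)
    imp : ∀ {φ ψ} → QuantifierFree φ → QuantifierFree ψ → QuantifierFree (φ ⇒ᶠ ψ)

  ∀* ∃* : ∀ m {n} → Formula α (m + n) → Formula α n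
  ∀* zero    φ = φ
  ∀* (suc m) φ = ∀* m (∀ᶠ φ)
  ∃* zero    φ = φ
  ∃* (suc m) φ = ∃* m (∃ᶠ φ)

  IsΠ₂ IsΣ₂ : ∀ {n} → Formula α n → Set
  IsΠ₂ {n} φ = ∃[ m ] ∃[ k ] Σ[ θ ∈ Formula α (k + (m + n)) ]
               QuantifierFree θ × φ ≡ ∀* m (∃* k θ)
  IsΣ₂ {n} φ = ∃[ m ] ∃[ k ] Σ[ θ ∈ Formula α (k + (m + n)) ]
               QuantifierFree θ × φ ≡ ∃* m (∀* k θ)

  module _ (A : Structure α) where
    open Structure A

    ⟦_⟧ᵗ : ∀ {n} → Term α n → Vector Carrier n → Carrier
    ⟦ var i ⟧ᵗ  ρ = ρ i
    ⟦ t ⊕ᵗ u ⟧ᵗ ρ = ⟦ t ⟧ᵗ ρ ⊕ ⟦ u ⟧ᵗ ρ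
    ⟦ ⊖ᵗ t ⟧ᵗ   ρ = ⊖ ⟦ t ⟧ᵗ ρ
    ⟦ cᵗ i t ⟧ᵗ ρ = c i (⟦ t ⟧ᵗ ρ)
    ⟦ dᵗ i j ⟧ᵗ ρ = d i j

    ⟦_⟧ : ∀ {n} → Formula α n → Vector Carrier n → Set₁
    ⟦ t ≈ᶠ u ⟧ ρ = Lift (lsuc 0ℓ) (⟦ t ⟧ᵗ ρ ≈ ⟦ u ⟧ᵗ ρ)
    ⟦ ¬ᶠ φ ⟧   ρ = ¬ ⟦ φ ⟧ ρ
    ⟦ φ ∧ᶠ ψ ⟧ ρ = ⟦ φ ⟧ ρ × ⟦ ψ ⟧ ρ
    ⟦ φ ∨ᶠ ψ ⟧ ρ = ⟦ φ ⟧ ρ ⊎ ⟦ ψ ⟧ ρ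
    ⟦ φ ⇒ᶠ ψ ⟧ ρ = ⟦ φ ⟧ ρ → ⟦ ψ ⟧ ρ
    ⟦ ∀ᶠ φ ⟧   ρ = ∀ x → ⟦ φ ⟧ (x ∷ ρ)
    ⟦ ∃ᶠ φ ⟧   ρ = ∃[ x ] ⟦ φ ⟧ (x ∷ ρ)

  LogicallyEquivalent : ∀ {n} → Formula α n → Formula α n → Set₂
  LogicallyEquivalent φ ψ = ∀ (A : Structure α) ρ → ⟦ A ⟧ φ ρ ⇔ ⟦ A ⟧ ψ ρ

  Δ₂ : ∀ {n} → Formula α n → Set₂
  Δ₂ {n} φ = (Σ[ ψ ∈ Formula α n ] IsΠ₂ ψ × LogicallyEquivalent φ ψ) ×
             (Σ[ ψ ∈ Formula α n ] IsΣ₂ ψ × LogicallyEquivalent φ ψ)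

  -- A formula is valid in an algebra when every assignment satisfies it.
  ValidIn : ∀ {k n} → (Structure α → Set k) → Formula α n → Set (k ⊔ lsuc (lsuc 0ℓ))
  ValidIn 𝒦 φ = ∀ A → 𝒦 A → ∀ ρ → ⟦ A ⟧ φ ρ

{-# OPTIONS --safe #-}

-- An element x of an Lf_α that does not lie below d_ij is never an atom.
-- Indeed pick distinct k and l outside {i , j} and the dimension set of x.
-- If x · d_kl = 0 then d_kl ≤ - x, and applying c_k gives 1 ≤ - x.  If
-- x ≤ d_kl then substituting i for k and j for l, neither of which x depends
-- on, gives x ≤ d_ij.  So d_kl splits x.  In a full set algebra over a base
-- with two elements, on the other hand, {s} is an atom not below d_ij whenever
-- s_i ≠ s_j.  The formula
--     ∃ y (x ≤ d_ij  ∨  (x · y ≠ 0  ∧  x · - y ≠ 0))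
-- with free variable x is Σ₁, hence both Π₂ and Σ₂.
module Submission where

open import Defs
open import Level using (0ℓ; Lift; lift; lower) renaming (suc to lsuc)
open import Algebra.Lattice.Bundles using (BooleanAlgebra)
import Algebra.Lattice.Properties.BooleanAlgebra as BooleanAlgebraProperties
open import Axiom.ExcludedMiddle using (ExcludedMiddle)
open import Data.Bool.Base using (Bool; true; false)
open import Data.Empty using (⊥-elim)
open import Data.Fin.Base using (Fin; zero; suc)
open import Data.List.Base using (List; []; _∷_; length; lookup; deduplicate)
open import Data.List.Membership.Propositional using (_∉_)
import Data.List.Membership.DecPropositional as DecMembership
open import Data.List.Membership.Propositional.Properties using (∈-lookup)
import Data.List.Relation.Unary.All as All
open import Data.List.Relation.Unary.AllPairs using (_∷_)
open import Data.List.Relation.Unary.Any using (here; there)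
open import Data.List.Relation.Unary.Enumerates.Setoid using (IsEnumeration)
open import Data.List.Relation.Unary.Enumerates.Setoid.Properties
  using (deduplicate⁺; lookup-surjective)
open import Data.List.Relation.Unary.Unique.Propositional using (Unique)
open import Data.List.Relation.Unary.Unique.DecPropositional.Properties using (deduplicate-!)
open import Data.Nat.Base using (ℕ)
open import Data.Product using (Σ-syntax; ∃-syntax; _×_; _,_)
open import Data.Sum using (inj₁; inj₂)
open import Data.Unit.Base using (⊤; tt)
open import Function.Base using (id; _∘_)
open import Function.Bundles using (_↔_; mk⤖)
open import Function.Construct.Identity using (⇔-id)
open import Function.Definitions using (Injective)
open import Function.Properties.Bijection using (⤖⇒↔)
open import Function.Properties.Inverse using (↔-sym)
open import Relation.Binary.Definitions using (DecidableEquality)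
open import Relation.Binary.Structures using (IsEquivalence)
open import Relation.Binary.PropositionalEquality as ≡ using (_≡_; _≢_; _≗_; refl)
import Relation.Binary.Reasoning.Setoid as ≈-Reasoning
open import Relation.Nullary using (¬_; Dec; yes; no)
open import Relation.Nullary.Decidable using (decidable-stable; map′)

-- Finiteness from enumerations, and fresh indices.

Unique⇒lookup-injective : ∀ {A : Set} {xs : List A} → Unique xs →
                          Injective _≡_ _≡_ (lookup xs)
Unique⇒lookup-injective (_ ∷ _)  {zero}  {zero}  _  = refl
Unique⇒lookup-injective (x∉ ∷ _) {zero}  {suc j} p = ⊥-elim (All.lookup x∉ (∈-lookup j) p)
Unique⇒lookup-injective (x∉ ∷ _) {suc i} {zero}  p =
  ⊥-elim (All.lookup x∉ (∈-lookup i) (≡.sym p))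
Unique⇒lookup-injective (_ ∷ u)  {suc i} {suc j} p =
  ≡.cong suc (Unique⇒lookup-injective u p)

-- Removing duplicates keeps the list exhaustive and makes `lookup` injective, hence a bijection.
enumeration⇒↔Fin : ∀ {A : Set} → DecidableEquality A → ∀ {xs} →
                   IsEnumeration (≡.setoid A) xs → ∃[ n ] (A ↔ Fin n)
enumeration⇒↔Fin {A} _≟_ {xs} enum =
  length ys , ↔-sym (⤖⇒↔ (mk⤖
    ( Unique⇒lookup-injective (deduplicate-! _≟_ xs)
    , lookup-surjective (≡.setoid A) (deduplicate⁺ (≡.decSetoid _≟_) enum))))
  where ys = deduplicate _≟_ xs

lower-em : ExcludedMiddle (lsuc 0ℓ) → (P : Set) → Dec P
lower-em em P = map′ lower lift (em {Lift (lsuc 0ℓ) P})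

module _ (em : ExcludedMiddle (lsuc 0ℓ)) (α : Ordinal) (inf : Infinite α) where
  open Ordinal α using (Index; _≟_)
  open DecMembership _≟_ using (_∈?_)

  -- If no index were outside `L`, then `L` would enumerate `Index`, contradicting infinity.
  infinite⇒fresh : (L : List Index) → ∃[ i ] i ∉ L
  infinite⇒fresh L = decidable-stable (lower-em em _) λ none →
    inf (enumeration⇒↔Fin _≟_ {xs = L} λ i →
      decidable-stable (i ∈? L) λ i∉L → none (i , i∉L))

-- Two equational forms of the Boolean order.

module _ {ℓ₁ ℓ₂} (B : BooleanAlgebra ℓ₁ ℓ₂) where
  open BooleanAlgebra B renaming (¬_ to −_; ⊤ to 1#)
  open BooleanAlgebraProperties B
    using (∧-identityˡ; ∨-zeroˡ; ∨-identityˡ)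
  open ≈-Reasoning setoid

  -- The cylindric axioms express x ≤ y as x + y = y, the formula as - x + y = 1; this lemma and the
  -- next translate between the two.
  ∨≈⇒−∨≈1 : ∀ {x y} → x ∨ y ≈ y → − x ∨ y ≈ 1#
  ∨≈⇒−∨≈1 {x} {y} x≤y = begin
    − x ∨ y        ≈⟨ ∨-congˡ x≤y ⟨
    − x ∨ (x ∨ y)  ≈⟨ ∨-assoc _ _ _ ⟨
    (− x ∨ x) ∨ y  ≈⟨ ∨-congʳ (∨-complementˡ x) ⟩
    1# ∨ y         ≈⟨ ∨-zeroˡ y ⟩
    1#             ∎

  −∨≈1⇒∨≈ : ∀ {x y} → − x ∨ y ≈ 1# → x ∨ y ≈ y
  −∨≈1⇒∨≈ {x} {y} h = begin
    x ∨ y                ≈⟨ ∧-identityˡ _ ⟨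
    1# ∧ (x ∨ y)         ≈⟨ ∧-congʳ h ⟨
    (− x ∨ y) ∧ (x ∨ y)  ≈⟨ ∨-distribʳ-∧ _ _ _ ⟨
    (− x ∧ x) ∨ y        ≈⟨ ∨-congʳ (∧-complementˡ x) ⟩
    _ ∨ y                ≈⟨ ∨-identityˡ y ⟩
    y                    ∎

  −∨-trans : ∀ {x y z} → − x ∨ y ≈ 1# → − y ∨ z ≈ 1# → − x ∨ z ≈ 1#
  −∨-trans {x} {y} {z} p q = ∨≈⇒−∨≈1 (begin
    x ∨ z        ≈⟨ ∨-congˡ y≤z ⟨
    x ∨ (y ∨ z)  ≈⟨ ∨-assoc _ _ _ ⟨
    (x ∨ y) ∨ z  ≈⟨ ∨-congʳ (−∨≈1⇒∨≈ p) ⟩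
    y ∨ z        ≈⟨ y≤z ⟩
    z            ∎)
    where y≤z = −∨≈1⇒∨≈ q

-- Elements fixed by a cylindrification, and substitution of indices.

module _ {α : Ordinal} (A : Structure α) (ca : IsCA A) where
  open Structure A
  open IsCA ca
  private
    boolean : BooleanAlgebra _ _
    boolean = record { isBooleanAlgebra = isBoolean }
  open BooleanAlgebra boolean
    using (setoid; trans; ∨-congˡ; ∨-congʳ; ∨-cong; ∨-comm; ∨-assoc)
  open BooleanAlgebraProperties boolean using (¬-involutive; ∨-zeroˡ)
  open ≈-Reasoning setoid

  c-fixes-⊖ : ∀ {i x} → c i x ≈ x → c i (⊖ x) ≈ ⊖ x
  c-fixes-⊖ {i} {x} fix = begin
    c i (⊖ x)      ≈⟨ c-cong i (⊖-cong fix) ⟨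
    c i (⊖ c i x)  ≈⟨ c-compl i x ⟩
    ⊖ c i x        ≈⟨ ⊖-cong fix ⟩
    ⊖ x            ∎

  c-fixes-⊕ : ∀ {i x y} → c i x ≈ x → c i y ≈ y → c i (x ⊕ y) ≈ x ⊕ y
  c-fixes-⊕ {i} p q = trans (c-add i _ _) (∨-cong p q)

  -- By `d-trans`, d_kl is itself a value of c_i, and c_i is idempotent.
  c-fixes-d : ∀ {i k l} → k ≢ i → k ≢ l → i ≢ l → c i (d k l) ≈ d k l
  c-fixes-d {i} {k} {l} k≢i k≢l i≢l = begin
    c i (d k l)                  ≈⟨ c-cong i (d-trans k≢i k≢l i≢l) ⟨
    c i (c i (d k i · d i l))    ≈⟨ c-idem i _ ⟨
    c i (d k i · d i l)          ≈⟨ d-trans k≢i k≢l i≢l ⟩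
    d k l                        ∎

  -- Applying c_i to d_il ≤ x turns the left side into 1 and leaves x as it is.
  fixed-above-d⇒𝟏 : ∀ {i l x} → i ≢ l → c i x ≈ x → ⊖ d i l ⊕ x ≈ 𝟏 → x ≈ 𝟏
  fixed-above-d⇒𝟏 {i} {l} {x} i≢l fix h = begin
    x                    ≈⟨ fix ⟨
    c i x                ≈⟨ c-cong i (−∨≈1⇒∨≈ boolean h) ⟨
    c i (d i l ⊕ x)      ≈⟨ c-add i _ _ ⟩
    c i (d i l) ⊕ c i x  ≈⟨ ∨-congʳ (c-d i≢l) ⟩
    𝟏 ⊕ c i x            ≈⟨ ∨-zeroˡ _ ⟩
    𝟏                    ∎

  -- From x ≤ d_ki and d_ki · d_il ≤ d_kl follows d_il ≤ - x + d_kl. The right side is fixed by c_i,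
  -- so it equals 1.
  fixed-below-d⇒substitute : ∀ {i k l x} → k ≢ i → k ≢ l → i ≢ l → c i x ≈ x →
                             ⊖ x ⊕ d k i ≈ 𝟏 → ⊖ x ⊕ d k l ≈ 𝟏
  fixed-below-d⇒substitute {i} {k} {l} {x} k≢i k≢l i≢l fix x≤dki =
    fixed-above-d⇒𝟏 i≢l (c-fixes-⊕ (c-fixes-⊖ fix) (c-fixes-d k≢i k≢l i≢l)) (begin
      ⊖ d i l ⊕ (⊖ x ⊕ d k l)   ≈⟨ ∨-assoc _ _ _ ⟨
      (⊖ d i l ⊕ ⊖ x) ⊕ d k l   ≈⟨ ∨-congʳ (∨-comm _ _) ⟩
      (⊖ x ⊕ ⊖ d i l) ⊕ d k l   ≈⟨ ∨-assoc _ _ _ ⟩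
      ⊖ x ⊕ (⊖ d i l ⊕ d k l)   ≈⟨ −∨-trans boolean x≤dki dki≤ ⟩
      𝟏                         ∎)
    where
    -- This is d_ki · d_il ≤ d_kl with d_il moved to the right: d_kl is c_i of the product, and c_i
    -- is increasing.
    dki≤ : ⊖ d k i ⊕ (⊖ d i l ⊕ d k l) ≈ 𝟏
    dki≤ = begin
      ⊖ d k i ⊕ (⊖ d i l ⊕ d k l)                 ≈⟨ ∨-assoc _ _ _ ⟨
      (⊖ d k i ⊕ ⊖ d i l) ⊕ d k l                 ≈⟨ ∨-cong (¬-involutive _) (d-trans k≢i k≢l i≢l) ⟨
      ⊖ (d k i · d i l) ⊕ c i (d k i · d i l)     ≈⟨ ∨≈⇒−∨≈1 boolean (c-incr i _) ⟩
      𝟏                                           ∎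

  -- Two substitutions: k becomes i in d_lk, then l becomes j in d_il. The replaced index must stand
  -- second, hence the uses of `d-sym`.
  fixed-below-d⇒below-all-d : ∀ {i j k l x} → i ≢ j → k ≢ i → k ≢ j → l ≢ i → l ≢ j → k ≢ l →
                              c k x ≈ x → c l x ≈ x → ⊖ x ⊕ d k l ≈ 𝟏 → ⊖ x ⊕ d i j ≈ 𝟏
  fixed-below-d⇒below-all-d i≢j k≢i k≢j l≢i l≢j k≢l fixk fixl x≤dkl =
    fixed-below-d⇒substitute (≡.≢-sym l≢i) i≢j l≢j fixl
      (trans (∨-congˡ (d-sym (≡.≢-sym l≢i)))
        (fixed-below-d⇒substitute (≡.≢-sym k≢l) l≢i k≢i fixk
          (trans (∨-congˡ (d-sym (≡.≢-sym k≢l))) x≤dkl)))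

-- The formula, its complexity and its validity in Lf.

module _ {α : Ordinal} where
  open Ordinal α using (Index)

  -- Boolean conditions are written as equations with 1 = d_ii: x ≤ z as
  -- - x + z = 1 and x · z = 0 as - x + - z = 1.
  matrix : Index → Index → Formula α 2
  matrix i j =
    ((−x ⊕ᵗ dᵗ i j) ≈ᶠ one) ∨ᶠ
    ((¬ᶠ ((−x ⊕ᵗ y) ≈ᶠ one)) ∧ᶠ (¬ᶠ ((−x ⊕ᵗ (⊖ᵗ y)) ≈ᶠ one)))
    where
    y −x one : Term α 2
    y   = var zero
    −x  = ⊖ᵗ var (suc zero)
    one = dᵗ i i

  belowOrSplit : Index → Index → Formula α 1
  belowOrSplit i j = ∃ᶠ (matrix i j)

  belowOrSplit-Δ₂ : ∀ i j → Δ₂ (belowOrSplit i j)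
  belowOrSplit-Δ₂ i j =
    -- The one existential quantifier is the inner block of a Π₂ prefix, and below the outer block
    -- of a Σ₂ prefix; the universal block is empty both times.
    (belowOrSplit i j , (0 , 1 , matrix i j , qf , refl) , λ _ _ → ⇔-id _) ,
    (belowOrSplit i j , (1 , 0 , matrix i j , qf , refl) , λ _ _ → ⇔-id _)
    where
    qf : QuantifierFree (matrix i j)
    qf = or eq (and (neg eq) (neg eq))

  belowOrSplit-Lf : ExcludedMiddle (lsuc 0ℓ) → Infinite α →
                    ∀ {i j} → i ≢ j → ValidIn Lf (belowOrSplit i j)
  belowOrSplit-Lf em inf {i} {j} i≢j A (ca , finDim) ρ
    with em {let open Structure A in Lift (lsuc 0ℓ) (⊖ ρ zero ⊕ d i j ≈ d i i)} | finDim (ρ zero)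
  -- The first disjunct does not mention y, so any element would serve as witness.
  ... | yes x≤dij | _          = Structure.d A i j , inj₁ x≤dij
  ... | no  x≰dij | L , fixed
    with k , k∉ ← infinite⇒fresh em α inf (i ∷ j ∷ L)
    with l , l∉ ← infinite⇒fresh em α inf (k ∷ i ∷ j ∷ L) =
      d k l , inj₂
        ( (λ (lift x≤dkl) → x≰dij (lift (=1⇒=dii
            (fixed-below-d⇒below-all-d A ca i≢j k≢i k≢j l≢i l≢j k≢l fixk fixl
              (=dii⇒=1 x≤dkl)))))
        -- Read as d_kl ≤ - x, the assumption forces - x = 1, so x would lie below d_ij after all.
        , (λ (lift xdkl=0) → x≰dij (lift (=1⇒=dii
            (trans (∨-congʳ (fixed-above-d⇒𝟏 A ca k≢l (c-fixes-⊖ A ca fixk)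
                     (trans (∨-comm _ _) (=dii⇒=1 xdkl=0))))
              (∨-zeroˡ _))))))
    where
    open Structure A
    open IsCA ca
    boolean : BooleanAlgebra _ _
    boolean = record { isBooleanAlgebra = isBoolean }
    open BooleanAlgebra boolean using (trans; sym; ∨-congʳ; ∨-comm)
    open BooleanAlgebraProperties boolean using (∨-zeroˡ)
    =dii⇒=1 : ∀ {x} → x ≈ d i i → x ≈ 𝟏
    =dii⇒=1 e = trans e (d-refl i)
    =1⇒=dii : ∀ {x} → x ≈ 𝟏 → x ≈ d i i
    =1⇒=dii e = trans e (sym (d-refl i))
    k≢i = k∉ ∘ here
    k≢j = k∉ ∘ there ∘ here
    k≢l : k ≢ l
    k≢l = l∉ ∘ here ∘ ≡.sym
    l≢i = l∉ ∘ there ∘ here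
    l≢j = l∉ ∘ there ∘ there ∘ here
    fixk = fixed k (k∉ ∘ there ∘ there)
    fixl = fixed l (l∉ ∘ there ∘ there ∘ there)

  -- The full set algebra that refutes the formula.

  sequences : (U : Set) → SeqSet {α} U
  sequences U = record { Holds = λ _ → ⊤ ; respects = λ _ _ → tt }

  -- The unit is a union of a single power and the subuniverse is everything, so the isomorphism
  -- merely attaches a trivial membership proof.
  fullSetAlgebra-RCA : ∀ U → RCA (FullSetAlgebra {α} (sequences U))
  fullSetAlgebra-RCA U =
    U , sequences U ,
    record
      { K        = ⊤
      ; W        = λ _ _ → ⊤
      ; union    = (λ _ → tt , λ _ → tt) , (λ _ → tt)
      ; disjoint = λ _ _ _ → refl
      } ,
    _ , everything ,
    record
      { to          = _, _
      ; isBijection = record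
        { isInjection = record
          { isCongruent = record
            { cong           = id
            ; isEquivalence₁ = isEquivalence
            ; isEquivalence₂ = Structure.isEquivalence (Subalgebra 𝑨 everything)
            }
          ; injective   = id
          }
        ; surjective  = λ (X , _) → X , id
        }
      ; ⊕-homo      = λ X Y → E.refl {X ⊕ Y}
      ; ⊖-homo      = λ X → E.refl {⊖ X}
      ; c-homo      = λ i X → E.refl {c i X}
      ; d-homo      = λ i j → E.refl {d i j}
      }
    where
    𝑨 = FullSetAlgebra {α} (sequences U)
    open Structure 𝑨
    everything : IsSubuniverse 𝑨 (λ _ → Lift _ ⊤)
    everything = record
      { ⊕-closed = λ _ _ → _
      ; ⊖-closed = λ _ → _
      ; c-closed = λ _ _ → _
      ; d-closed = λ _ _ → _
      }
    module E = IsEquivalence isEquivalence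

  singleton : ∀ {U} → (Index → U) → Sub {α} (sequences U)
  singleton s = record
    { set = record
      { Holds    = _≗ s
      ; respects = λ e p i → ≡.trans (≡.sym (e i)) (p i)
      }
    ; ⊆V = _
    }

  -- The point s lies outside D_ij, and {s} is an atom: s belongs to Y or to its complement, so one
  -- of the two contains {s}.
  singleton-¬belowOrSplit :
    ExcludedMiddle (lsuc 0ℓ) → ∀ {U i j} (s : Index → U) → s i ≢ s j →
    ¬ ⟦ FullSetAlgebra (sequences U) ⟧ (belowOrSplit i j) (λ _ → singleton s)
  singleton-¬belowOrSplit em {U} {i} {j} s si≢sj = refute
    where
    open SeqSet
    open Sub
    refute : ¬ ⟦ FullSetAlgebra (sequences U) ⟧ (belowOrSplit i j) (λ _ → singleton s)
    -- The inclusion of D_ii in - {s} ∪ D_ij is tested at s, which lies in neither part of the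
    -- union.
    refute (_ , inj₁ (lift (_ , below))) with below {s} (tt , refl)
    ... | inj₁ (_ , s∉) = s∉ λ _ → refl
    ... | inj₂ (_ , si≡sj) = si≢sj si≡sj
    refute (Y , inj₂ (x≰y , x≰-y)) = s∉Y s∈Y
      where
      -- This is {s} ≤ Z in the form used by the formula; excluded middle decides whether a sequence
      -- agrees with s.
      covers : (Z : Sub (sequences U)) → Holds (set Z) s →
               Structure._≈_ (FullSetAlgebra {α} (sequences U))
                 (_∪_ _ (V∖_ _ (singleton s)) Z) (D _ i i)
      covers Z s∈Z = (λ _ → tt , refl) , λ {t} _ → split t (lower-em em (t ≗ s))
        where
        split : ∀ t → Dec (t ≗ s) → Holds (set (_∪_ _ (V∖_ _ (singleton s)) Z)) t
        split t (yes t≗s) = inj₂ (respects (set Z) (λ k → ≡.sym (t≗s k)) s∈Z)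
        split t (no  t≭s) = inj₁ (tt , t≭s)
      s∉Y : ¬ Holds (set Y) s
      s∉Y s∈Y = x≰y (lift (covers Y s∈Y))
      s∈Y : Holds (set Y) s
      s∈Y = decidable-stable (lower-em em _) λ s∉ → x≰-y (lift (covers (V∖_ _ Y) (tt , s∉)))

corollary4p2 : ExcludedMiddle (lsuc 0ℓ) →
    (α : Ordinal) → Infinite α →
    Σ[ n ∈ ℕ ] Σ[ φ ∈ Formula α n ]
    Δ₂ φ × ValidIn Lf φ × ¬ ValidIn RCA φ
corollary4p2 em α inf
  with i , _ ← infinite⇒fresh em α inf []
  with j , j∉ ← infinite⇒fresh em α inf (i ∷ []) =
    1 , belowOrSplit i j , belowOrSplit-Δ₂ i j , belowOrSplit-Lf em inf i≢j ,
    λ valid → singleton-¬belowOrSplit em s si≢sj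
                (valid _ (fullSetAlgebra-RCA Bool) λ _ → singleton s)
  where
  open Ordinal α using (Index; _≟_)
  i≢j : i ≢ j
  i≢j = j∉ ∘ here ∘ ≡.sym
  -- A two-element base suffices: the sequence differs from a constant one only at i, so it
  -- separates i from j.
  s : Index → Bool
  s = _⟨_/_⟩ {α} (λ _ → false) i true
  si≢sj : s i ≢ s j
  si≢sj with i ≟ i | j ≟ i
  ... | yes _  | no _    = λ ()
  ... | yes _  | yes j≡i = λ _ → i≢j (≡.sym j≡i)
  ... | no i≢i | _       = λ _ → i≢i refl
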